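{- Let $k \ge 2$ be an integer, and let $G=(V,E)$ be a finite simple graph with each edge colored blue or red, with $|V|=4(k-1)$, such that every vertex in $V$ belongs to a monochromatic $k$-clique of each color, and such that $G$ is edge-critical with respect to this property (removing any edge destroys the property). Then $G$ is isomorphic (as a $2$-colored graph) to some $G(X,Y,B,R)$, where $B(X,Y)$ and $R(X,Y)$ are complementary $(k-1)$-regular bipartite graphs on the bipartition $(X,Y)$.
   Context: For an integer $k\ge 2$, let $X$ and $Y$ be disjoint sets of $2(k-1)$ vertices each, and let $B(X,Y)$ and $R(X,Y)$ be two complementary $(k-1)$-regular bipartite graphs on the bipartition $(X,Y)$ (i.e., they partition the edge set of the complete bipartite graph on $(X,Y)$ and each is $(k-1)$-regular). The $2$-colored graph $G(X,Y,B,R)$ has vertex set $X \cup Y$; it contains all edges of the complete bipartite graph on $(X,Y)$, with edges of $B(X,Y)$ colored blue and edges of $R(X,Y)$ colored red; in addition, any two vertices of $X$ having a common neighbor in $B(X,Y)$ are joined by a blue edge, and any two vertices of $Y$ having a common neighbor in $R(X,Y)$ are joined by a red edge; there are no other edges. A monochromatic $k$-clique of a color is a set of $k$ pairwise adjacent vertices all of whose connecting edges have that color. -}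

module Defs where

open import Data.Nat using (ℕ)
open import Data.Bool using (Bool; true; false; not)
open import Data.Fin using (Fin; _≟_)
open import Data.Fin.Subset using (∣_∣)
open import Data.Vec using (tabulate)
open import Data.Maybe using (Maybe; just; nothing)
open import Data.Product using (Σ; ∃; _×_)
open import Data.Sum using (_⊎_; inj₁; inj₂)
open import Relation.Nullary using (¬_; yes; no)
open import Relation.Binary.PropositionalEquality using (_≡_; _≢_)
open import Function.Definitions using (Injective)

data Color : Set where
  blue red : Color

-- A 2-edge-coloured graph on a vertex type V: c u v = nothing means no edge,
-- c u v = just col means an edge of colour col.
ColGraph : Set → Set
ColGraph V = V → V → Maybe Color

IsSimple : {V : Set} → ColGraph V → Set
IsSimple {V} c = (∀ (u v : V) → c u v ≡ c v u) × (∀ (v : V) → c v v ≡ nothing)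

InMonoClique : {n : ℕ} → ColGraph (Fin n) → ℕ → Color → Fin n → Set
InMonoClique {n} c k col v =
  Σ (Fin k → Fin n) λ f →
    Injective _≡_ _≡_ f ×
    (∃ λ i → f i ≡ v) ×
    (∀ i j → i ≢ j → c (f i) (f j) ≡ just col)

HasProperty : {n : ℕ} → ColGraph (Fin n) → ℕ → Set
HasProperty {n} c k = ∀ (v : Fin n) (col : Color) → InMonoClique c k col v

deleteEdge : {n : ℕ} → ColGraph (Fin n) → Fin n → Fin n → ColGraph (Fin n)
deleteEdge c u v a b with a ≟ u | b ≟ v | a ≟ v | b ≟ u
... | yes _ | yes _ | _     | _     = nothing
... | _     | _     | yes _ | yes _ = nothing
... | _     | _     | _     | _     = c a b

EdgeCritical : {n : ℕ} → ColGraph (Fin n) → ℕ → Set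
EdgeCritical c k = ∀ u v col → c u v ≡ just col → ¬ HasProperty (deleteEdge c u v) k

-- Bipartite graph B(X,Y) with X = Y = Fin m, as adjacency Bool matrix;
-- R(X,Y) is its complement  (R x y = not (B x y)).
-- d-regular bipartite graph: every vertex on each side has exactly d neighbours.
Regular : {m : ℕ} → (Fin m → Fin m → Bool) → ℕ → Set
Regular {m} A d =
  (∀ (x : Fin m) → ∣ tabulate (λ y → A x y) ∣ ≡ d) ×
  (∀ (y : Fin m) → ∣ tabulate (λ x → A x y) ∣ ≡ d)

-- The coloured graph G(X,Y,B,R) on X ⊎ Y, with X = inj₁, Y = inj₂,
-- given as the relation "there is an edge of colour col between a and b".
data ModelEdge {m : ℕ} (B : Fin m → Fin m → Bool) : Fin m ⊎ Fin m → Fin m ⊎ Fin m → Color → Set where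
  xy-blue : ∀ {x y} → B x y ≡ true  → ModelEdge B (inj₁ x) (inj₂ y) blue
  xy-red  : ∀ {x y} → B x y ≡ false → ModelEdge B (inj₁ x) (inj₂ y) red
  yx-blue : ∀ {x y} → B x y ≡ true  → ModelEdge B (inj₂ y) (inj₁ x) blue
  yx-red  : ∀ {x y} → B x y ≡ false → ModelEdge B (inj₂ y) (inj₁ x) red
  xx-blue : ∀ {x x' y} → x ≢ x' → B x y ≡ true → B x' y ≡ true → ModelEdge B (inj₁ x) (inj₁ x') blue
  yy-red  : ∀ {y y' x} → y ≢ y' → B x y ≡ false → B x y' ≡ false → ModelEdge B (inj₂ y) (inj₂ y') red

{-# OPTIONS --safe #-}
module Submission where

-- Put k = m + 1 and n = 4m, and choose irredundant covers of the vertex set by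
-- p blue cliques B_i and q red cliques R_j of size k; write 1 + b(v) and 1 + r(v)
-- for the numbers of cliques of each cover through v.  A blue and a red clique
-- share at most one vertex, so with α = p − k each R_j satisfies
--   Σ_{v ∈ R_j} b(v) + #{i : B_i ∩ R_j = ∅} = α.
-- Let s = Σ b(v) r(v) + #{(i, j) : B_i ∩ R_j = ∅}.  Summing over all j gives
-- s + p k = q α + n.  Call j bad if no v ∈ R_j has r(v) = 0 < b(v), and let d be
-- the number of v with b(v), r(v) > 0.  Summing over the bad j only gives
-- #bad · α ≤ s + d α, while counting own vertices (those lying in one clique of a
-- cover only) gives p + q + d ≤ n + #bad.
-- Together, p² ≤ n (α + 1), that is (p − 2m)² ≤ 0.  Hence p = q = 2m by symmetry,
-- s = 0, and B_i and R_j always meet.  The own vertices of the B_i and of the R_j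
-- can then be chosen disjoint, and they form the sides Y and X.  By criticality
-- every edge lies in a clique of the covers.

open import Defs
open import Data.Nat using (ℕ; zero; suc; pred; >-nonZero; _+_; _≤_; _<_; _*_; _∸_; z≤n; s≤s)
open import Data.Nat.Properties
open import Data.Nat.Tactic.RingSolver using (solve-∀)
open import Data.Bool using (Bool; true; false; not; _∧_)
open import Data.Fin using (Fin; zero; suc; punchIn; punchOut; opposite)
import Data.Fin.Properties as Fin
open import Data.Fin.Properties using (any?; all?; ¬∀⟶∃¬; punchIn-punchOut)
open import Data.Fin.Subset using (∣_∣)
open import Data.Vec using (tabulate)
open import Data.Sum using (_⊎_; inj₁; inj₂)
open import Data.Maybe using (just; nothing)
open import Data.Maybe.Properties using (just-injective)
open import Data.Product using (Σ; ∃; _×_; _,_; proj₁; proj₂)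
open import Data.Empty using (⊥-elim)
open import Function.Base using (_∘_)
open import Function.Bundles using (_⤖_; Bijection; mk↔ₛ′)
open import Function.Definitions using (Injective)
open import Function.Properties.Inverse using (↔⇒⤖)
open import Relation.Nullary using (¬_; Dec; yes; no; does; contradiction)
open import Relation.Nullary.Decidable using (dec-true; dec-false; decidable-stable; ¬?; _×-dec_; _→-dec_)
open import Relation.Binary.PropositionalEquality using (_≡_; _≢_; refl; sym; trans; cong; cong₂; subst; subst₂; module ≡-Reasoning)
open import Algebra.Properties.Semiring.Sum +-*-semiring using (sum; sum-syntax; sum-cong-≗; ∑-distrib-+; ∑-comm; *-distribˡ-sum; *-distribʳ-sum)

private variable
  k m n p q : ℕ

⟦_⟧ : Bool → ℕ
⟦ true ⟧  = 1
⟦ false ⟧ = 0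

⟦⟧≡1 : ∀ {b} → b ≡ true → ⟦ b ⟧ ≡ 1
⟦⟧≡1 refl = refl

⟦⟧-not : ∀ b → ⟦ b ⟧ + ⟦ not b ⟧ ≡ 1
⟦⟧-not true  = refl
⟦⟧-not false = refl

-- Finite sums of natural numbers

sum-mono-≤ : {f g : Fin n → ℕ} → (∀ i → f i ≤ g i) → sum f ≤ sum g
sum-mono-≤ {zero}  h = z≤n
sum-mono-≤ {suc n} h = +-mono-≤ (h zero) (sum-mono-≤ (h ∘ suc))

sum-const : ∀ n c → sum {n} (λ _ → c) ≡ n * c
sum-const zero    c = refl
sum-const (suc n) c = cong (c +_) (sum-const n c)

sum-1 : ∀ n → sum {n} (λ _ → 1) ≡ n
sum-1 n = trans (sum-const n 1) (*-identityʳ n)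

term≤sum : (f : Fin n → ℕ) → ∀ i → f i ≤ sum f
term≤sum f zero    = m≤m+n _ _
term≤sum f (suc i) = ≤-trans (term≤sum (f ∘ suc) i) (m≤n+m _ (f zero))

sum≡0⇒term≡0 : (f : Fin n → ℕ) → sum f ≡ 0 → ∀ i → f i ≡ 0
sum≡0⇒term≡0 f e i = n≤0⇒n≡0 (subst (f i ≤_) e (term≤sum f i))

terms≡0⇒sum≡0 : {f : Fin n → ℕ} → (∀ i → f i ≡ 0) → sum f ≡ 0
terms≡0⇒sum≡0 {n} h = trans (sum-cong-≗ h) (trans (sum-const n 0) (*-zeroʳ n))

sum-support : (f : Fin n → ℕ) → ∀ i → (∀ j → j ≢ i → f j ≡ 0) → sum f ≡ f i
sum-support f zero    h = trans (cong (f zero +_) (terms≡0⇒sum≡0 λ j → h (suc j) λ ())) (+-identityʳ _)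
sum-support f (suc i) h = cong₂ _+_ (h zero λ ()) (sum-support (f ∘ suc) i λ j j≢i → h (suc j) λ { refl → j≢i refl })

sum>0⇒term>0 : (f : Fin n → ℕ) → 0 < sum f → ∃ λ i → 0 < f i
sum>0⇒term>0 {suc n} f s with f zero in e
... | suc _ = zero , subst (0 <_) (sym e) (s≤s z≤n)
... | zero  = let i , h = sum>0⇒term>0 (f ∘ suc) s in suc i , h

sum-indicator-≤1 : (b : Fin n → Bool) → (∀ i j → b i ≡ true → b j ≡ true → i ≡ j) → sum (⟦_⟧ ∘ b) ≤ 1
sum-indicator-≤1 {zero}  b h = z≤n
sum-indicator-≤1 {suc n} b h with b zero in e
... | false = sum-indicator-≤1 (b ∘ suc) λ i j x y → Fin.suc-injective (h (suc i) (suc j) x y)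
... | true  = s≤s (≤-reflexive (terms≡0⇒sum≡0 rest))
  where
  rest : ∀ i → ⟦ b (suc i) ⟧ ≡ 0
  rest i with b (suc i) in e′
  ... | false = refl
  ... | true  = contradiction (h zero (suc i) e e′) λ ()

sum-indicator-≡1 : (b : Fin n → Bool) → sum (⟦_⟧ ∘ b) ≡ 1 → ∀ i j → b i ≡ true → b j ≡ true → i ≡ j
sum-indicator-≡1 {suc n} b s zero zero _ _ = refl
sum-indicator-≡1 {suc n} b s zero (suc j) x y rewrite x
  = contradiction (trans (sym (sum≡0⇒term≡0 (⟦_⟧ ∘ b ∘ suc) (suc-injective s) j)) (⟦⟧≡1 y)) λ ()
sum-indicator-≡1 {suc n} b s (suc i) zero x y rewrite y
  = contradiction (trans (sym (sum≡0⇒term≡0 (⟦_⟧ ∘ b ∘ suc) (suc-injective s) i)) (⟦⟧≡1 x)) λ ()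
sum-indicator-≡1 {suc n} b s (suc i) (suc j) x y with b zero
... | true  = contradiction (trans (sym (sum≡0⇒term≡0 (⟦_⟧ ∘ b ∘ suc) (suc-injective s) i)) (⟦⟧≡1 x)) λ ()
... | false = cong suc (sum-indicator-≡1 (b ∘ suc) s i j x y)

-- The slacks `1 ∸ f j` are exact because of the upper bound, and they add up to 0.
sum-tight : (f : Fin n → ℕ) → (∀ i → f i ≤ 1) → sum f ≡ n → ∀ i → f i ≡ 1
sum-tight {n} f f≤1 s i = ≤-antisym (f≤1 i) (m∸n≡0⇒m≤n (sum≡0⇒term≡0 (λ j → 1 ∸ f j) slack i))
  where
  slack : ∑[ j < n ] (1 ∸ f j) ≡ 0
  slack = +-cancelˡ-≡ n _ _ (begin
    n + ∑[ j < n ] (1 ∸ f j)      ≡⟨ cong (_+ ∑[ j < n ] (1 ∸ f j)) (sym s) ⟩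
    sum f + ∑[ j < n ] (1 ∸ f j)  ≡⟨ ∑-distrib-+ f _ ⟨
    ∑[ j < n ] (f j + (1 ∸ f j))  ≡⟨ sum-cong-≗ (λ j → m+[n∸m]≡n (f≤1 j)) ⟩
    ∑[ j < n ] 1                  ≡⟨ sum-1 n ⟩
    n                             ≡⟨ +-identityʳ n ⟨
    n + 0                         ∎)
    where open ≡-Reasoning

∣tabulate∣≡sum : (b : Fin n → Bool) → ∣ tabulate b ∣ ≡ sum (⟦_⟧ ∘ b)
∣tabulate∣≡sum {zero}  b = refl
∣tabulate∣≡sum {suc n} b with b zero
... | true  = cong suc (∣tabulate∣≡sum (b ∘ suc))
... | false = ∣tabulate∣≡sum (b ∘ suc)

-- Irredundant covers by k-sets

record Cover (k p n : ℕ) : Set where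
  field
    mem    : Fin p → Fin n → Bool
    size   : ∀ i → ∑[ v < n ] ⟦ mem i v ⟧ ≡ k
    covers : ∀ v → ∃ λ i → mem i v ≡ true

  deg : Fin n → ℕ
  deg v = ∑[ i < p ] ⟦ mem i v ⟧

  field
    -- Irredundance: a vertex of degree 1 makes the set that contains it indispensable.
    own : ∀ i → ∃ λ v → mem i v ≡ true × deg v ≡ 1

  -- This is b(v) or r(v) of the overview; every vertex is covered, so `pred` loses nothing.
  excess : Fin n → ℕ
  excess v = pred (deg v)

  deg≡suc-excess : ∀ v → deg v ≡ suc (excess v)
  deg≡suc-excess v = sym (suc-pred (deg v) {{ >-nonZero (let i , e = covers v in
    ≤-trans (≤-reflexive (sym (⟦⟧≡1 e))) (term≤sum (λ i → ⟦ mem i v ⟧) i)) }})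

  -- Double counting of incidences: the weight of v is collected once for each set through v.
  ∑-weighted : (w : Fin n → ℕ) → ∑[ i < p ] ∑[ v < n ] (⟦ mem i v ⟧ * w v) ≡ ∑[ v < n ] (suc (excess v) * w v)
  ∑-weighted w = trans (∑-comm λ i v → ⟦ mem i v ⟧ * w v) (sum-cong-≗ λ v →
    trans (sym (*-distribʳ-sum (w v) λ i → ⟦ mem i v ⟧)) (cong (_* w v) (deg≡suc-excess v)))

  ∑excess : ∑[ v < n ] excess v + n ≡ p * k
  ∑excess = begin
    ∑[ v < n ] excess v + n               ≡⟨ cong (sum excess +_) (sum-1 n) ⟨
    sum excess + ∑[ v < n ] 1             ≡⟨ ∑-distrib-+ excess (λ _ → 1) ⟨
    ∑[ v < n ] (excess v + 1)             ≡⟨ sum-cong-≗ (λ v → trans (+-comm (excess v) 1) (sym (deg≡suc-excess v))) ⟩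
    ∑[ v < n ] ∑[ i < p ] ⟦ mem i v ⟧     ≡⟨ ∑-comm (λ v i → ⟦ mem i v ⟧) ⟩
    ∑[ i < p ] ∑[ v < n ] ⟦ mem i v ⟧     ≡⟨ sum-cong-≗ size ⟩
    ∑[ i < p ] k                          ≡⟨ sum-const p k ⟩
    p * k                                 ∎
    where open ≡-Reasoning

-- Double counting between a blue and a red cover

isZero isPos : ℕ → ℕ
isZero zero    = 1
isZero (suc _) = 0
isPos zero    = 0
isPos (suc _) = 1

isZero+isPos : ∀ x → isZero x + isPos x ≡ 1
isZero+isPos zero    = refl
isZero+isPos (suc _) = refl

isPos≤ : ∀ x → isPos x ≤ x
isPos≤ zero    = z≤n
isPos≤ (suc _) = s≤s z≤n

-- Used after `∑-weighted`: a weight living on vertices of excess 0 is collected exactly once.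
suc-*-isZero : ∀ x c → suc x * (isZero x * c) ≡ isZero x * c
suc-*-isZero zero    c = *-identityˡ _
suc-*-isZero (suc x) c = *-zeroʳ (suc (suc x))

meet : Cover k p n → Cover k q n → Fin p → Fin q → ℕ
meet {n = n} B R i j = ∑[ v < n ] (⟦ Cover.mem B i v ⟧ * ⟦ Cover.mem R j v ⟧)

module Counting (B : Cover k p n) (R : Cover k q n) (meet≤1 : ∀ i j → meet B R i j ≤ 1) where
  open ≤-Reasoning
  private
    module B = Cover B
    module R = Cover R

  -- Since `meet` is at most 1, this is the indicator of B_i and R_j being disjoint.
  gap : Fin p → Fin q → ℕ
  gap i j = 1 ∸ meet B R i j

  gaps : ℕ
  gaps = ∑[ j < q ] ∑[ i < p ] gap i j

  surplus : ℕ
  surplus = ∑[ v < n ] (B.excess v * R.excess v)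

  row : Fin q → ℕ
  row j = ∑[ v < n ] (⟦ R.mem j v ⟧ * B.excess v) + ∑[ i < p ] gap i j

  -- Each of the p blue sets either meets R_j in one vertex or has a gap with it. Counted from the k
  -- vertices of R_j, the meetings number Σ (1 + b(v)).
  k+row≡p : ∀ j → k + row j ≡ p
  k+row≡p j = begin-equality
    k + row j
      ≡⟨ +-assoc k _ _ ⟨
    k + ∑[ v < n ] (⟦ R.mem j v ⟧ * B.excess v) + ∑[ i < p ] gap i j
      ≡⟨ cong (_+ sum (λ i → gap i j)) meets ⟨
    ∑[ i < p ] meet B R i j + ∑[ i < p ] gap i j
      ≡⟨ ∑-distrib-+ (λ i → meet B R i j) (λ i → gap i j) ⟨
    ∑[ i < p ] (meet B R i j + gap i j)
      ≡⟨ sum-cong-≗ (λ i → m+[n∸m]≡n (meet≤1 i j)) ⟩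
    ∑[ i < p ] 1
      ≡⟨ sum-1 p ⟩
    p ∎
    where
    meets : ∑[ i < p ] meet B R i j ≡ k + ∑[ v < n ] (⟦ R.mem j v ⟧ * B.excess v)
    meets = begin-equality
      ∑[ i < p ] meet B R i j
        ≡⟨ B.∑-weighted (λ v → ⟦ R.mem j v ⟧) ⟩
      ∑[ v < n ] (⟦ R.mem j v ⟧ + B.excess v * ⟦ R.mem j v ⟧)
        ≡⟨ ∑-distrib-+ (λ v → ⟦ R.mem j v ⟧) _ ⟩
      ∑[ v < n ] ⟦ R.mem j v ⟧ + ∑[ v < n ] (B.excess v * ⟦ R.mem j v ⟧)
        ≡⟨ cong₂ _+_ (R.size j) (sum-cong-≗ λ v → *-comm (B.excess v) _) ⟩
      k + ∑[ v < n ] (⟦ R.mem j v ⟧ * B.excess v) ∎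

  α : ℕ
  α = p ∸ k

  row≡α : ∀ j → row j ≡ α
  row≡α j = trans (sym (m+n∸m≡n k (row j))) (cong (_∸ k) (k+row≡p j))

  p≡k+α : Fin q → p ≡ k + α
  p≡k+α j = trans (sym (k+row≡p j)) (cong (k +_) (row≡α j))

  -- The excess of v is one of the summands of `row j` for any red set R_j through v.
  excess≤α : ∀ v → B.excess v ≤ α
  excess≤α v = let j , e = R.covers v in ≤-trans
    (≤-reflexive (trans (sym (*-identityˡ _)) (cong (_* B.excess v) (sym (⟦⟧≡1 e)))))
    (≤-trans (term≤sum (λ v → ⟦ R.mem j v ⟧ * B.excess v) v)
    (≤-trans (m≤m+n _ _) (≤-reflexive (row≡α j))))


  -- Sum `row≡α` over all j: the blue excess of v appears in 1 + r(v) rows, which yields b(v) once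
  -- and b(v) r(v) as surplus.
  ∑excess+surplus+gaps : sum B.excess + (surplus + gaps) ≡ q * α
  ∑excess+surplus+gaps = begin-equality
    sum B.excess + (surplus + gaps)
      ≡⟨ +-assoc (sum B.excess) surplus gaps ⟨
    sum B.excess + surplus + gaps
      ≡⟨ cong (_+ gaps) (∑-distrib-+ B.excess (λ v → B.excess v * R.excess v)) ⟨
    ∑[ v < n ] (B.excess v + B.excess v * R.excess v) + gaps
      ≡⟨ cong (_+ gaps) (sum-cong-≗ λ v → cong (B.excess v +_) (*-comm (B.excess v) _)) ⟩
    ∑[ v < n ] (suc (R.excess v) * B.excess v) + gaps
      ≡⟨ cong (_+ gaps) (R.∑-weighted B.excess) ⟨
    ∑[ j < q ] ∑[ v < n ] (⟦ R.mem j v ⟧ * B.excess v) + gaps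
      ≡⟨ ∑-distrib-+ (λ j → ∑[ v < n ] (⟦ R.mem j v ⟧ * B.excess v)) _ ⟨
    ∑[ j < q ] row j
      ≡⟨ sum-cong-≗ row≡α ⟩
    ∑[ j < q ] α
      ≡⟨ sum-const q α ⟩
    q * α ∎

  -- The vertices counted have r(v) = 0, so none of them is counted for two different j.
  good : Fin q → ℕ
  good j = ∑[ v < n ] (⟦ R.mem j v ⟧ * (isZero (R.excess v) * isPos (B.excess v)))

  bad : Fin q → ℕ
  bad j = isZero (good j)

  both : ℕ
  both = ∑[ v < n ] (isPos (B.excess v) * isPos (R.excess v))

  private
    bad≤1 : ∀ j → bad j ≤ 1
    bad≤1 j = subst (bad j ≤_) (isZero+isPos (good j)) (m≤m+n _ _)

    -- If b(v) = 0, the left side vanishes. If b(v) > 0 = r(v), then v makes every red set through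
    -- it good, so again nothing is left. Otherwise at most all 1 + r(v) red sets through v are bad;
    -- one copy of b(v) is bounded by α and the others give the product.
    bad-excess : ∀ v → ∑[ j < q ] (bad j * (⟦ R.mem j v ⟧ * B.excess v))
      ≤ B.excess v * R.excess v + isPos (B.excess v) * isPos (R.excess v) * α
    bad-excess v = go (B.excess v) (R.excess v) refl refl
      where
      go : ∀ x y → B.excess v ≡ x → R.excess v ≡ y →
        ∑[ j < q ] (bad j * (⟦ R.mem j v ⟧ * x)) ≤ x * y + isPos x * isPos y * α
      go zero y ex ey = ≤-reflexive (terms≡0⇒sum≡0 λ j →
        trans (cong (bad j *_) (*-zeroʳ ⟦ R.mem j v ⟧)) (*-zeroʳ (bad j)))
      go (suc x) zero ex ey = ≤-trans (≤-reflexive (terms≡0⇒sum≡0 vanish)) z≤n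
        where
        vanish : ∀ j → bad j * (⟦ R.mem j v ⟧ * suc x) ≡ 0
        vanish j with R.mem j v in e
        ... | false = *-zeroʳ (bad j)
        ... | true with good j | good>0
          where
          good>0 : 1 ≤ good j
          good>0 = subst (_≤ good j) (cong₂ _*_ (⟦⟧≡1 e) (cong₂ _*_ (cong isZero ey) (cong isPos ex)))
            (term≤sum (λ v → ⟦ R.mem j v ⟧ * (isZero (R.excess v) * isPos (B.excess v))) v)
        ... | suc _ | _ = refl
      go (suc x) (suc y) ex ey = begin
        ∑[ j < q ] (bad j * (⟦ R.mem j v ⟧ * suc x))
          ≤⟨ sum-mono-≤ (λ j → ≤-trans (*-monoˡ-≤ _ (bad≤1 j)) (≤-reflexive (*-identityˡ _))) ⟩
        ∑[ j < q ] (⟦ R.mem j v ⟧ * suc x)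
          ≡⟨ *-distribʳ-sum (suc x) (λ j → ⟦ R.mem j v ⟧) ⟨
        R.deg v * suc x
          ≡⟨ cong (_* suc x) (trans (R.deg≡suc-excess v) (cong suc ey)) ⟩
        suc x + suc y * suc x
          ≤⟨ +-monoˡ-≤ _ (subst (_≤ α) ex (excess≤α v)) ⟩
        α + suc y * suc x
          ≡⟨ trans (+-comm α _) (cong₂ _+_ (*-comm (suc y) (suc x)) (sym (*-identityˡ α))) ⟩
        suc x * suc y + 1 * α ∎

  -- Sum `row≡α` over the bad j only, bounding the excess part vertex by vertex and keeping all
  -- gaps.
  ∑bad*α≤ : ∑[ j < q ] bad j * α ≤ surplus + gaps + both * α
  ∑bad*α≤ = begin
    ∑[ j < q ] bad j * α
      ≡⟨ *-distribʳ-sum α bad ⟩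
    ∑[ j < q ] (bad j * α)
      ≡⟨ sum-cong-≗ (λ j → trans (cong (bad j *_) (sym (row≡α j))) (*-distribˡ-+ (bad j) _ _)) ⟩
    ∑[ j < q ] (bad j * ∑[ v < n ] (⟦ R.mem j v ⟧ * B.excess v) + bad j * ∑[ i < p ] gap i j)
      ≡⟨ ∑-distrib-+ (λ j → bad j * ∑[ v < n ] (⟦ R.mem j v ⟧ * B.excess v)) _ ⟩
    ∑[ j < q ] (bad j * ∑[ v < n ] (⟦ R.mem j v ⟧ * B.excess v)) + ∑[ j < q ] (bad j * ∑[ i < p ] gap i j)
      ≤⟨ +-mono-≤ excesses (sum-mono-≤ λ j → ≤-trans (*-monoˡ-≤ _ (bad≤1 j)) (≤-reflexive (*-identityˡ _))) ⟩
    surplus + both * α + gaps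
      ≡⟨ rearrange surplus (both * α) gaps ⟩
    surplus + gaps + both * α ∎
    where
    rearrange : ∀ a b c → a + b + c ≡ a + c + b
    rearrange = solve-∀
    excesses : ∑[ j < q ] (bad j * ∑[ v < n ] (⟦ R.mem j v ⟧ * B.excess v)) ≤ surplus + both * α
    excesses = begin
      ∑[ j < q ] (bad j * ∑[ v < n ] (⟦ R.mem j v ⟧ * B.excess v))
        ≡⟨ sum-cong-≗ (λ j → *-distribˡ-sum (bad j) λ v → ⟦ R.mem j v ⟧ * B.excess v) ⟩
      ∑[ j < q ] ∑[ v < n ] (bad j * (⟦ R.mem j v ⟧ * B.excess v))
        ≡⟨ ∑-comm (λ j v → bad j * (⟦ R.mem j v ⟧ * B.excess v)) ⟩
      ∑[ v < n ] ∑[ j < q ] (bad j * (⟦ R.mem j v ⟧ * B.excess v))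
        ≤⟨ sum-mono-≤ bad-excess ⟩
      ∑[ v < n ] (B.excess v * R.excess v + isPos (B.excess v) * isPos (R.excess v) * α)
        ≡⟨ ∑-distrib-+ (λ v → B.excess v * R.excess v) _ ⟩
      surplus + ∑[ v < n ] (isPos (B.excess v) * isPos (R.excess v) * α)
        ≡⟨ cong (surplus +_) (*-distribʳ-sum α λ v → isPos (B.excess v) * isPos (R.excess v)) ⟨
      surplus + both * α ∎

  -- The vertices split into three classes: b = 0, then b > 0 = r, then both positive. The first has
  -- an own vertex of each B_i, the second a vertex for each good R_j, and the third has size
  -- `both`.
  p+q+both≤n+∑bad : p + q + both ≤ n + sum bad
  p+q+both≤n+∑bad = begin
    p + q + both
      ≡⟨ cong (λ x → p + x + both) q≡ ⟩
    p + (∑[ j < q ] isPos (good j) + sum bad) + both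
      ≤⟨ +-monoˡ-≤ both (+-mono-≤ p≤ (+-monoˡ-≤ (sum bad) (sum-mono-≤ λ j → isPos≤ (good j)))) ⟩
    ∑[ v < n ] isZero (B.excess v) + (sum good + sum bad) + both
      ≡⟨ rearrange (∑[ v < n ] isZero (B.excess v)) (sum good) (sum bad) both ⟩
    ∑[ v < n ] isZero (B.excess v) + (sum good + both) + sum bad
      ≡⟨ cong (_+ sum bad) partition ⟩
    n + sum bad ∎
    where
    rearrange : ∀ a b c d → a + (b + c) + d ≡ a + (b + d) + c
    rearrange = solve-∀
    q≡ : q ≡ ∑[ j < q ] isPos (good j) + sum bad
    q≡ = begin-equality
      q                                          ≡⟨ sum-1 q ⟨
      ∑[ j < q ] 1                               ≡⟨ sum-cong-≗ (λ j → trans (sym (isZero+isPos (good j))) (+-comm (bad j) _)) ⟩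
      ∑[ j < q ] (isPos (good j) + bad j)        ≡⟨ ∑-distrib-+ (isPos ∘ good) bad ⟩
      ∑[ j < q ] isPos (good j) + sum bad        ∎
    p≤ : p ≤ ∑[ v < n ] isZero (B.excess v)
    p≤ = begin
      p
        ≡⟨ sum-1 p ⟨
      ∑[ i < p ] 1
        ≤⟨ sum-mono-≤ (λ i → let v , e , d = B.own i in
             subst (_≤ ∑[ v < n ] (⟦ B.mem i v ⟧ * (isZero (B.excess v) * 1)))
               (cong₂ _*_ (⟦⟧≡1 e) (cong (λ x → isZero (pred x) * 1) d))
               (term≤sum (λ v → ⟦ B.mem i v ⟧ * (isZero (B.excess v) * 1)) v)) ⟩
      ∑[ i < p ] ∑[ v < n ] (⟦ B.mem i v ⟧ * (isZero (B.excess v) * 1))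
        ≡⟨ B.∑-weighted (λ v → isZero (B.excess v) * 1) ⟩
      ∑[ v < n ] (suc (B.excess v) * (isZero (B.excess v) * 1))
        ≡⟨ sum-cong-≗ (λ v → trans (suc-*-isZero (B.excess v) 1) (*-identityʳ _)) ⟩
      ∑[ v < n ] isZero (B.excess v) ∎
    classify : ∀ x y → isZero x + (isZero y * isPos x + isPos x * isPos y) ≡ 1
    classify zero    zero    = refl
    classify zero    (suc _) = refl
    classify (suc _) zero    = refl
    classify (suc _) (suc _) = refl
    partition : ∑[ v < n ] isZero (B.excess v) + (sum good + both) ≡ n
    partition = begin-equality
      ∑[ v < n ] isZero (B.excess v) + (sum good + both)
        ≡⟨ cong (λ x → ∑[ v < n ] isZero (B.excess v) + (x + both))
             (trans (R.∑-weighted λ v → isZero (R.excess v) * isPos (B.excess v))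
                    (sum-cong-≗ λ v → suc-*-isZero (R.excess v) (isPos (B.excess v)))) ⟩
      ∑[ v < n ] isZero (B.excess v) + (∑[ v < n ] (isZero (R.excess v) * isPos (B.excess v)) + both)
        ≡⟨ cong (∑[ v < n ] isZero (B.excess v) +_) (∑-distrib-+ (λ v → isZero (R.excess v) * isPos (B.excess v)) _) ⟨
      ∑[ v < n ] isZero (B.excess v) + ∑[ v < n ] (isZero (R.excess v) * isPos (B.excess v) + isPos (B.excess v) * isPos (R.excess v))
        ≡⟨ ∑-distrib-+ (isZero ∘ B.excess) _ ⟨
      ∑[ v < n ] (isZero (B.excess v) + (isZero (R.excess v) * isPos (B.excess v) + isPos (B.excess v) * isPos (R.excess v)))
        ≡⟨ sum-cong-≗ (λ v → classify (B.excess v) (R.excess v)) ⟩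
      ∑[ v < n ] 1
        ≡⟨ sum-1 n ⟩
      n ∎

  -- Write p² as p k + p α. The own-vertex count multiplied by α bounds the second term, and
  -- `∑bad*α≤` together with the two exact identities eliminates the bad sets, the surplus and the
  -- gaps. What is common to both sides is (q + both) α, added in advance. The index j serves to
  -- show p = k + α.
  p*p≤n*[1+α] : Fin q → p * p ≤ n * suc α
  p*p≤n*[1+α] j = +-cancelˡ-≤ ((q + both) * α) _ _ (begin
    (q + both) * α + p * p
      ≡⟨ cong (λ x → (q + both) * α + p * x) (p≡k+α j) ⟩
    (q + both) * α + p * (k + α)
      ≡⟨ rearrange₁ p q both k α ⟩
    (p + q + both) * α + p * k
      ≤⟨ +-monoˡ-≤ (p * k) (*-monoˡ-≤ α p+q+both≤n+∑bad) ⟩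
    (n + sum bad) * α + p * k
      ≡⟨ cong (_+ p * k) (*-distribʳ-+ α n (sum bad)) ⟩
    n * α + sum bad * α + p * k
      ≤⟨ +-monoˡ-≤ (p * k) (+-monoʳ-≤ (n * α) ∑bad*α≤) ⟩
    n * α + (surplus + gaps + both * α) + p * k
      ≡⟨ cong (n * α + (surplus + gaps + both * α) +_) B.∑excess ⟨
    n * α + (surplus + gaps + both * α) + (sum B.excess + n)
      ≡⟨ rearrange₂ n α (surplus + gaps) both (sum B.excess) ⟩
    sum B.excess + (surplus + gaps) + (both * α + n * suc α)
      ≡⟨ cong (_+ (both * α + n * suc α)) ∑excess+surplus+gaps ⟩
    q * α + (both * α + n * suc α)
      ≡⟨ rearrange₃ q both α (n * suc α) ⟩
    (q + both) * α + n * suc α ∎)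
    where
    rearrange₁ : ∀ p q d k a → (q + d) * a + p * (k + a) ≡ (p + q + d) * a + p * k
    rearrange₁ = solve-∀
    rearrange₂ : ∀ n a s d e → n * a + (s + d * a) + (e + n) ≡ e + s + (d * a + n * (1 + a))
    rearrange₂ = solve-∀
    rearrange₃ : ∀ q d a x → q * a + (d * a + x) ≡ (q + d) * a + x
    rearrange₃ = solve-∀

-- The hypotheses say (n − m)² ≤ 0.
square≤4mn∧m≤n⇒n≡m : m ≤ n → (m + n) * (m + n) ≤ 4 * m * n → n ≡ m
square≤4mn∧m≤n⇒n≡m {m} m≤n sq with d , refl ← m≤n⇒∃[o]m+o≡n m≤n =
  trans (cong (m +_) (square≡0 d (n≤0⇒n≡0 (+-cancelˡ-≤ (4 * m * (m + d)) _ _ (begin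
    4 * m * (m + d) + d * d        ≡⟨ identity m d ⟩
    (m + (m + d)) * (m + (m + d))  ≤⟨ sq ⟩
    4 * m * (m + d)                ≡⟨ +-identityʳ _ ⟨
    4 * m * (m + d) + 0            ∎))))) (+-identityʳ m)
  where
  open ≤-Reasoning
  square≡0 : ∀ d → d * d ≡ 0 → d ≡ 0
  square≡0 zero _ = refl
  identity : ∀ m d → 4 * m * (m + d) + d * d ≡ (m + (m + d)) * (m + (m + d))
  identity = solve-∀

square≤4mn⇒n≡m : ∀ m n → (m + n) * (m + n) ≤ 4 * m * n → n ≡ m
square≤4mn⇒n≡m m n sq with ≤-total m n
... | inj₁ m≤n = square≤4mn∧m≤n⇒n≡m m≤n sq
... | inj₂ n≤m = sym (square≤4mn∧m≤n⇒n≡m n≤m (≤-trans (≤-reflexive (comm₁ n m)) (≤-trans sq (≤-reflexive (comm₂ m n)))))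
  where
  comm₁ : ∀ a m → (a + m) * (a + m) ≡ (m + a) * (m + a)
  comm₁ = solve-∀
  comm₂ : ∀ m a → 4 * m * a ≡ 4 * a * m
  comm₂ = solve-∀

-- The number of cliques in each cover

meet-comm : (B : Cover k p n) (R : Cover k q n) → ∀ i j → meet B R i j ≡ meet R B j i
meet-comm B R i j = sum-cong-≗ λ v → *-comm ⟦ Cover.mem B i v ⟧ _

-- Here m = k - 1 is `suc h`. As p = m + (α + 1) and n = 4m, the bound on p² says that m and α + 1
-- satisfy the reverse of the inequality between arithmetic and geometric mean, so they are equal.
cover-size : ∀ h → (B : Cover (2 + h) p (4 * suc h)) (R : Cover (2 + h) q (4 * suc h)) →
  (∀ i j → meet B R i j ≤ 1) → p ≡ 2 * suc h
cover-size {p = p} h B R meet≤1 = begin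
  p                ≡⟨ p≡ ⟩
  suc h + suc α    ≡⟨ cong (suc h +_) (square≤4mn⇒n≡m (suc h) (suc α)
                        (subst (λ x → x * x ≤ 4 * suc h * suc α) p≡ (p*p≤n*[1+α] j))) ⟩
  suc h + suc h    ≡⟨ cong (suc h +_) (+-identityʳ (suc h)) ⟨
  2 * suc h        ∎
  where
  open ≡-Reasoning
  open Counting B R meet≤1
  j = proj₁ (Cover.covers R zero)
  p≡ : p ≡ suc h + suc α
  p≡ = trans (p≡k+α j) (cong suc (sym (+-suc h α)))

-- The extremal case and the choice of disjoint own vertices

module Extremal h (B R : Cover (2 + h) (2 * suc h) (4 * suc h)) (meet≤1 : ∀ i j → meet B R i j ≤ 1) where
  open Counting B R meet≤1
  private
    module B = Cover B
    module R = Cover R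

  α≡h : α ≡ h
  α≡h = +-cancelˡ-≡ (2 + h) α h (trans (sym (p≡k+α (proj₁ (R.covers zero)))) (identity h))
    where
    identity : ∀ h → 2 * (1 + h) ≡ 2 + h + h
    identity = solve-∀

  -- With p = q = 2m, the total blue excess p k - n already equals q α, which leaves nothing for the
  -- rest of `∑excess+surplus+gaps`.
  surplus+gaps≡0 : surplus + gaps ≡ 0
  surplus+gaps≡0 = +-cancelˡ-≡ (2 * suc h * (2 + h)) _ _ (begin
    2 * suc h * (2 + h) + (surplus + gaps)             ≡⟨ cong (_+ (surplus + gaps)) B.∑excess ⟨
    sum B.excess + 4 * suc h + (surplus + gaps)        ≡⟨ rearrange (sum B.excess) (4 * suc h) (surplus + gaps) ⟩
    sum B.excess + (surplus + gaps) + 4 * suc h        ≡⟨ cong (_+ 4 * suc h) (trans ∑excess+surplus+gaps (cong (2 * suc h *_) α≡h)) ⟩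
    2 * suc h * h + 4 * suc h                          ≡⟨ identity h ⟩
    2 * suc h * (2 + h) + 0                            ∎)
    where
    open ≡-Reasoning
    rearrange : ∀ a b c → a + b + c ≡ a + c + b
    rearrange = solve-∀
    identity : ∀ h → 2 * (1 + h) * h + 4 * (1 + h) ≡ 2 * (1 + h) * (2 + h) + 0
    identity = solve-∀

  meet≡1 : ∀ i j → meet B R i j ≡ 1
  meet≡1 i j = ≤-antisym (meet≤1 i j) (m∸n≡0⇒m≤n
    (sum≡0⇒term≡0 (λ i → gap i j) (sum≡0⇒term≡0 (λ j → ∑[ i < 2 * suc h ] gap i j) (m+n≡0⇒n≡0 surplus surplus+gaps≡0) j) i))

  both≡0 : both ≡ 0
  both≡0 = terms≡0⇒sum≡0 λ v → isPos-* (B.excess v) (R.excess v)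
    (sum≡0⇒term≡0 (λ v → B.excess v * R.excess v) (m+n≡0⇒m≡0 surplus surplus+gaps≡0) v)
    where
    isPos-* : ∀ x y → x * y ≡ 0 → isPos x * isPos y ≡ 0
    isPos-* zero    y       _ = refl
    isPos-* (suc x) zero    _ = refl

  ∑bad*h≡0 : sum bad * h ≡ 0
  ∑bad*h≡0 = n≤0⇒n≡0 (subst (λ x → sum bad * x ≤ 0) α≡h (subst (sum bad * α ≤_)
    (cong₂ _+_ surplus+gaps≡0 (cong (_* α) both≡0)) ∑bad*α≤))

  -- For h ≥ 1 the vanishing of `sum bad * h` leaves no bad set. The vertex found is an own vertex
  -- of R_j but not of any blue set.
  good-vertex : 1 ≤ h → ∀ j → ∃ λ v → R.mem j v ≡ true × R.excess v ≡ 0 × 1 ≤ B.excess v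
  good-vertex (s≤s _) j with sum>0⇒term>0 _ (isZero≡0 (good j) (sum≡0⇒term≡0 bad (m*n≡0⇒m≡0 (sum bad) h ∑bad*h≡0) j))
    where
    isZero≡0 : ∀ x → isZero x ≡ 0 → 0 < x
    isZero≡0 (suc x) _ = s≤s z≤n
  ... | v , pos = v , factors (R.mem j v) (R.excess v) (B.excess v) pos
    where
    factors : ∀ b x y → 0 < ⟦ b ⟧ * (isZero x * isPos y) → b ≡ true × x ≡ 0 × 1 ≤ y
    factors true zero (suc y) _ = refl , refl , s≤s z≤n

  -- For k = 2 the bound α on the excess is 0, so `good-vertex` cannot be used and the two sides
  -- need another choice.
  excess≡0 : h ≡ 0 → ∀ v → B.excess v ≡ 0
  excess≡0 h≡0 v = n≤0⇒n≡0 (subst (B.excess v ≤_) (trans α≡h h≡0) (excess≤α v))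

record Transversal (B : Cover k p n) (R : Cover k q n) : Set where
  private
    module B = Cover B
    module R = Cover R
  field
    y    : Fin p → Fin n
    x    : Fin q → Fin n
    y∈   : ∀ i → B.mem i (y i) ≡ true
    x∈   : ∀ j → R.mem j (x j) ≡ true
    degy : ∀ i → B.deg (y i) ≡ 1
    degx : ∀ j → R.deg (x j) ≡ 1
    y≢x  : ∀ i j → y i ≢ x j

transversal : ∀ h (B R : Cover (2 + h) (2 * suc h) (4 * suc h)) → (∀ i j → meet B R i j ≤ 1) → Transversal B R
transversal (suc h) B R meet≤1 = record
  { y    = λ i → proj₁ (ys i)
  ; x    = λ j → proj₁ (xs j)
  ; y∈   = λ i → proj₁ (proj₂ (ys i))
  ; x∈   = λ j → proj₁ (proj₂ (xs j))
  ; degy = λ i → trans (Cover.deg≡suc-excess B _) (cong suc (proj₁ (proj₂ (proj₂ (ys i)))))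
  ; degx = λ j → trans (Cover.deg≡suc-excess R _) (cong suc (proj₁ (proj₂ (proj₂ (xs j)))))
  -- `x j` has positive blue excess, while `y i`, obtained with the colours exchanged, has blue
  -- excess 0.
  ; y≢x  = λ i j e → >⇒≢ (proj₂ (proj₂ (proj₂ (xs j))))
             (trans (cong (Cover.excess B) (sym e)) (proj₁ (proj₂ (proj₂ (ys i)))))
  }
  where
  xs = Extremal.good-vertex (suc h) B R meet≤1 (s≤s z≤n)
  ys = Extremal.good-vertex (suc h) R B (λ j i → subst (_≤ 1) (meet-comm B R i j) (meet≤1 i j)) (s≤s z≤n)
-- For k = 2 every vertex is an own vertex for both colours; the diagonal
-- crossings serve as y and the antidiagonal ones as x.
transversal zero B R meet≤1 = record
  { y    = λ i → w i i
  ; x    = λ j → w (opposite j) j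
  ; y∈   = λ i → w∈B i i
  ; x∈   = λ j → w∈R (opposite j) j
  ; degy = λ i → degB _
  ; degx = λ j → degR _
  -- Degree 1 in both covers determines the row and the column of a crossing, so equality would give
  -- `opposite j ≡ i` and `i ≡ j`.
  ; y≢x  = λ i j e → opposite≢ j (trans
      (sum-indicator-≡1 (λ i → B.mem i (w (opposite j) j)) (degB _) _ _
        (w∈B (opposite j) j) (subst (λ v → B.mem i v ≡ true) e (w∈B i i)))
      (sum-indicator-≡1 (λ i → R.mem i (w (opposite j) j)) (degR _) _ _
        (subst (λ v → R.mem i v ≡ true) e (w∈R i i)) (w∈R (opposite j) j)))
  }
  where
  module B = Cover B
  module R = Cover R
  open Extremal 0 B R meet≤1 using (meet≡1; excess≡0)
  crossing : ∀ i j → ∃ λ v → 0 < ⟦ B.mem i v ⟧ * ⟦ R.mem j v ⟧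
  crossing i j = sum>0⇒term>0 _ (≤-reflexive (sym (meet≡1 i j)))
  both-true : ∀ a b → 0 < ⟦ a ⟧ * ⟦ b ⟧ → a ≡ true × b ≡ true
  both-true true true _ = refl , refl
  w : Fin 2 → Fin 2 → Fin 4
  w i j = proj₁ (crossing i j)
  w∈B : ∀ i j → B.mem i (w i j) ≡ true
  w∈B i j = proj₁ (both-true (B.mem i (w i j)) (R.mem j (w i j)) (proj₂ (crossing i j)))
  w∈R : ∀ i j → R.mem j (w i j) ≡ true
  w∈R i j = proj₂ (both-true (B.mem i (w i j)) (R.mem j (w i j)) (proj₂ (crossing i j)))
  degB : ∀ v → B.deg v ≡ 1
  degB v = trans (B.deg≡suc-excess v) (cong suc (excess≡0 refl v))
  degR : ∀ v → R.deg v ≡ 1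
  degR v = trans (R.deg≡suc-excess v) (cong suc
    (Extremal.excess≡0 0 R B (λ j i → subst (_≤ 1) (meet-comm B R i j) (meet≤1 i j)) refl v))
  opposite≢ : ∀ (j : Fin 2) → opposite j ≢ j
  opposite≢ zero       ()
  opposite≢ (suc zero) ()

-- Reindexing along a transversal

_==_ : Fin n → Fin n → Bool
u == v = does (u Fin.≟ v)

==-refl : (u : Fin n) → ⟦ u == u ⟧ ≡ 1
==-refl u = cong ⟦_⟧ (dec-true (u Fin.≟ u) refl)

==-≢ : {u v : Fin n} → u ≢ v → ⟦ u == v ⟧ ≡ 0
==-≢ {u = u} {v} u≢v = cong ⟦_⟧ (dec-false (u Fin.≟ v) u≢v)

sum-== : (f : Fin n → ℕ) (u : Fin n) → ∑[ v < n ] (⟦ u == v ⟧ * f v) ≡ f u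
sum-== f u = trans
  (sum-support _ u λ v v≢u → cong (_* f v) (==-≢ (v≢u ∘ sym)))
  (trans (cong (_* f u) (==-refl u)) (*-identityˡ (f u)))

sum-==1 : (u : Fin n) → ∑[ v < n ] ⟦ u == v ⟧ ≡ 1
sum-==1 u = trans (sum-cong-≗ λ v → sym (*-identityʳ ⟦ u == v ⟧)) (sum-== (λ _ → 1) u)

sum-image : (f : Fin q → Fin n) → Injective _≡_ _≡_ f → ∀ {j v} → f j ≡ v → ∑[ i < q ] ⟦ f i == v ⟧ ≡ 1
sum-image f inj {j} refl = trans (sum-support _ j λ i i≢j → ==-≢ (i≢j ∘ inj)) (==-refl (f j))

sum-coimage : (f : Fin q → Fin n) → ∀ {v} → (∀ j → f j ≢ v) → ∑[ i < q ] ⟦ f i == v ⟧ ≡ 0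
sum-coimage f f≢v = terms≡0⇒sum≡0 λ i → ==-≢ (f≢v i)

module DisjointImages
  (x : Fin q → Fin n) (y : Fin p → Fin n)
  (x-injective : Injective _≡_ _≡_ x) (y-injective : Injective _≡_ _≡_ y)
  (y≢x : ∀ i j → y i ≢ x j) (q+p≡n : q + p ≡ n) where

  open ≡-Reasoning

  hits : Fin n → ℕ
  hits v = ∑[ j < q ] ⟦ x j == v ⟧ + ∑[ i < p ] ⟦ y i == v ⟧

  hits≤1 : ∀ v → hits v ≤ 1
  hits≤1 v with any? (λ j → x j Fin.≟ v) | any? (λ i → y i Fin.≟ v)
  ... | yes (j , refl) | _            = ≤-reflexive (cong₂ _+_ (sum-image x x-injective refl) (sum-coimage y λ i → y≢x i j))
  ... | no ∄j          | yes (i , eq) = ≤-reflexive (cong₂ _+_ (sum-coimage x λ j e → ∄j (j , e)) (sum-image y y-injective eq))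
  ... | no ∄j          | no ∄i        = ≤-trans (≤-reflexive (cong₂ _+_ (sum-coimage x λ j e → ∄j (j , e)) (sum-coimage y λ i e → ∄i (i , e)))) z≤n

  -- No vertex is hit twice, and the q + p = n hits are spread over n vertices.
  hits≡1 : ∀ v → hits v ≡ 1
  hits≡1 = sum-tight hits hits≤1 (begin
    ∑[ v < n ] hits v
      ≡⟨ ∑-distrib-+ (λ v → ∑[ j < q ] ⟦ x j == v ⟧) _ ⟩
    ∑[ v < n ] ∑[ j < q ] ⟦ x j == v ⟧ + ∑[ v < n ] ∑[ i < p ] ⟦ y i == v ⟧
      ≡⟨ cong₂ _+_ (∑-comm λ v j → ⟦ x j == v ⟧) (∑-comm λ v i → ⟦ y i == v ⟧) ⟩
    ∑[ j < q ] ∑[ v < n ] ⟦ x j == v ⟧ + ∑[ i < p ] ∑[ v < n ] ⟦ y i == v ⟧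
      ≡⟨ cong₂ _+_ (sum-cong-≗ (sum-==1 ∘ x)) (sum-cong-≗ (sum-==1 ∘ y)) ⟩
    ∑[ j < q ] 1 + ∑[ i < p ] 1
      ≡⟨ cong₂ _+_ (sum-1 q) (sum-1 p) ⟩
    q + p
      ≡⟨ q+p≡n ⟩
    n ∎)

  reindex : (f : Fin n → ℕ) → sum f ≡ ∑[ j < q ] f (x j) + ∑[ i < p ] f (y i)
  reindex f = begin
    sum f
      ≡⟨ sum-cong-≗ (λ v → trans (cong (_* f v) (hits≡1 v)) (*-identityˡ (f v))) ⟨
    ∑[ v < n ] (hits v * f v)
      ≡⟨ sum-cong-≗ (λ v → *-distribʳ-+ (f v) (∑[ j < q ] ⟦ x j == v ⟧) _) ⟩
    ∑[ v < n ] (∑[ j < q ] ⟦ x j == v ⟧ * f v + ∑[ i < p ] ⟦ y i == v ⟧ * f v)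
      ≡⟨ ∑-distrib-+ (λ v → ∑[ j < q ] ⟦ x j == v ⟧ * f v) _ ⟩
    ∑[ v < n ] (∑[ j < q ] ⟦ x j == v ⟧ * f v) + ∑[ v < n ] (∑[ i < p ] ⟦ y i == v ⟧ * f v)
      ≡⟨ cong₂ _+_ (along x) (along y) ⟩
    ∑[ j < q ] f (x j) + ∑[ i < p ] f (y i) ∎
    where
    along : (z : Fin m → Fin n) → ∑[ v < n ] (∑[ j < m ] ⟦ z j == v ⟧ * f v) ≡ ∑[ j < m ] f (z j)
    along {m} z = begin
      ∑[ v < n ] (∑[ j < m ] ⟦ z j == v ⟧ * f v)    ≡⟨ sum-cong-≗ (λ v → *-distribʳ-sum (f v) λ j → ⟦ z j == v ⟧) ⟩
      ∑[ v < n ] ∑[ j < m ] (⟦ z j == v ⟧ * f v)    ≡⟨ ∑-comm (λ v j → ⟦ z j == v ⟧ * f v) ⟩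
      ∑[ j < m ] ∑[ v < n ] (⟦ z j == v ⟧ * f v)    ≡⟨ sum-cong-≗ (sum-== f ∘ z) ⟩
      ∑[ j < m ] f (z j)                            ∎

  from : Fin q ⊎ Fin p → Fin n
  from (inj₁ j) = x j
  from (inj₂ i) = y i

  from-injective : ∀ {s t} → from s ≡ from t → s ≡ t
  from-injective {inj₁ j} {inj₁ j′} e = cong inj₁ (x-injective e)
  from-injective {inj₁ j} {inj₂ i}  e = contradiction (sym e) (y≢x i j)
  from-injective {inj₂ i} {inj₁ j}  e = contradiction e (y≢x i j)
  from-injective {inj₂ i} {inj₂ i′} e = cong inj₂ (y-injective e)

  preimage : ∀ v → ∃ λ s → from s ≡ v
  preimage v with any? (λ j → x j Fin.≟ v) | any? (λ i → y i Fin.≟ v)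
  ... | yes (j , e) | _           = inj₁ j , e
  ... | no _        | yes (i , e) = inj₂ i , e
  ... | no ∄j       | no ∄i       = contradiction
    (trans (sym (hits≡1 v)) (cong₂ _+_ (sum-coimage x λ j e → ∄j (j , e)) (sum-coimage y λ i e → ∄i (i , e)))) λ ()

  bijection : Fin n ⤖ (Fin q ⊎ Fin p)
  bijection = ↔⇒⤖ (mk↔ₛ′ (proj₁ ∘ preimage) from
    (λ s → from-injective (proj₂ (preimage (from s)))) (proj₂ ∘ preimage))

-- The regular bipartite graph given by a transversal

complement : {f g : Fin n → ℕ} → n ≡ m + m → (∀ i → f i + g i ≡ 1) → sum f ≡ m → sum g ≡ m
complement {n} {m} {f} {g} n≡m+m f+g≡1 ∑f = +-cancelˡ-≡ m _ _ (begin
  m + sum g                ≡⟨ cong (_+ sum g) ∑f ⟨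
  sum f + sum g            ≡⟨ ∑-distrib-+ f g ⟨
  ∑[ i < n ] (f i + g i)   ≡⟨ sum-cong-≗ f+g≡1 ⟩
  ∑[ i < n ] 1             ≡⟨ sum-1 n ⟩
  n                        ≡⟨ n≡m+m ⟩
  m + m                    ∎)
  where open ≡-Reasoning

module Model {m N n} (B R : Cover (suc m) N n) (N≡m+m : N ≡ m + m) (N+N≡n : N + N ≡ n)
  (meet≡1 : ∀ i j → meet B R i j ≡ 1) (T : Transversal B R) where
  open Transversal T public
  private
    module B = Cover B
    module R = Cover R

  y-own : ∀ {i i′} → B.mem i (y i′) ≡ true → i ≡ i′
  y-own {i} {i′} e = sum-indicator-≡1 (λ i → B.mem i (y i′)) (degy i′) i i′ e (y∈ i′)

  x-own : ∀ {j j′} → R.mem j (x j′) ≡ true → j ≡ j′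
  x-own {j} {j′} e = sum-indicator-≡1 (λ j → R.mem j (x j′)) (degx j′) j j′ e (x∈ j′)

  y-injective : Injective _≡_ _≡_ y
  y-injective {i} e = y-own (subst (λ v → B.mem i v ≡ true) e (y∈ i))

  x-injective : Injective _≡_ _≡_ x
  x-injective {j} e = x-own (subst (λ v → R.mem j v ≡ true) e (x∈ j))

  open DisjointImages x y x-injective y-injective y≢x N+N≡n public
    using (from; preimage; bijection; reindex)

  ⟦B-y⟧≡0 : ∀ {i i′} → i′ ≢ i → ⟦ B.mem i (y i′) ⟧ ≡ 0
  ⟦B-y⟧≡0 {i} {i′} i′≢i with B.mem i (y i′) in e
  ... | true  = contradiction (sym (y-own e)) i′≢i
  ... | false = refl

  ⟦R-x⟧≡0 : ∀ {j j′} → j′ ≢ j → ⟦ R.mem j (x j′) ⟧ ≡ 0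
  ⟦R-x⟧≡0 {j} {j′} j′≢j with R.mem j (x j′) in e
  ... | true  = contradiction (sym (x-own e)) j′≢j
  ... | false = refl

  -- Blue adjacency of `x j` and `y i`: the only blue set through `y i` is B_i, so it decides.
  A : Fin N → Fin N → Bool
  A j i = B.mem i (x j)

  -- B_i lies in {y_i} ∪ X and R_j in {x_j} ∪ Y, so their unique common vertex is x_j or y_i.
  dual : ∀ j i → ⟦ A j i ⟧ + ⟦ R.mem j (y i) ⟧ ≡ 1
  dual j i = begin
    ⟦ A j i ⟧ + ⟦ R.mem j (y i) ⟧
      ≡⟨ cong₂ _+_ (trans (cong (⟦ A j i ⟧ *_) (⟦⟧≡1 (x∈ j))) (*-identityʳ _))
                   (trans (cong (_* ⟦ R.mem j (y i) ⟧) (⟦⟧≡1 (y∈ i))) (*-identityˡ _)) ⟨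
    ⟦ A j i ⟧ * ⟦ R.mem j (x j) ⟧ + ⟦ B.mem i (y i) ⟧ * ⟦ R.mem j (y i) ⟧
      ≡⟨ cong₂ _+_ (sum-support _ j λ j′ ≢j → trans (cong (⟦ A j′ i ⟧ *_) (⟦R-x⟧≡0 ≢j)) (*-zeroʳ ⟦ A j′ i ⟧))
                   (sum-support _ i λ i′ ≢i → cong (_* ⟦ R.mem j (y i′) ⟧) (⟦B-y⟧≡0 ≢i)) ⟨
    ∑[ j′ < N ] (⟦ B.mem i (x j′) ⟧ * ⟦ R.mem j (x j′) ⟧) + ∑[ i′ < N ] (⟦ B.mem i (y i′) ⟧ * ⟦ R.mem j (y i′) ⟧)
      ≡⟨ reindex (λ v → ⟦ B.mem i v ⟧ * ⟦ R.mem j v ⟧) ⟨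
    meet B R i j
      ≡⟨ meet≡1 i j ⟩
    1 ∎
    where open ≡-Reasoning

  -- Of the m + 1 vertices of B_i only `y i` lies on the Y side.
  ∑A-column : ∀ i → ∑[ j < N ] ⟦ A j i ⟧ ≡ m
  ∑A-column i = +-cancelʳ-≡ 1 _ _ (begin
    ∑[ j < N ] ⟦ A j i ⟧ + 1
      ≡⟨ cong (sum (λ j → ⟦ A j i ⟧) +_) (trans (sum-support _ i λ i′ → ⟦B-y⟧≡0) (⟦⟧≡1 (y∈ i))) ⟨
    ∑[ j < N ] ⟦ A j i ⟧ + ∑[ i′ < N ] ⟦ B.mem i (y i′) ⟧
      ≡⟨ reindex (λ v → ⟦ B.mem i v ⟧) ⟨
    ∑[ v < n ] ⟦ B.mem i v ⟧
      ≡⟨ B.size i ⟩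
    suc m
      ≡⟨ +-comm 1 m ⟩
    m + 1 ∎)
    where open ≡-Reasoning

  ∑R-row : ∀ j → ∑[ i < N ] ⟦ R.mem j (y i) ⟧ ≡ m
  ∑R-row j = suc-injective (begin
    1 + ∑[ i < N ] ⟦ R.mem j (y i) ⟧
      ≡⟨ cong (_+ sum (λ i → ⟦ R.mem j (y i) ⟧)) (trans (sum-support _ j λ j′ → ⟦R-x⟧≡0) (⟦⟧≡1 (x∈ j))) ⟨
    ∑[ j′ < N ] ⟦ R.mem j (x j′) ⟧ + ∑[ i < N ] ⟦ R.mem j (y i) ⟧
      ≡⟨ reindex (λ v → ⟦ R.mem j v ⟧) ⟨
    ∑[ v < n ] ⟦ R.mem j v ⟧
      ≡⟨ R.size j ⟩
    suc m ∎)
    where open ≡-Reasoning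

  -- By `dual`, the blue neighbours of `x j` are the complement in Y of the m vertices of R_j there,
  -- and Y has 2m vertices.
  ∑A-row : ∀ j → ∑[ i < N ] ⟦ A j i ⟧ ≡ m
  ∑A-row j = complement N≡m+m (λ i → trans (+-comm ⟦ R.mem j (y i) ⟧ _) (dual j i)) (∑R-row j)

  regular : Regular A m
  regular = (λ j → trans (∣tabulate∣≡sum (A j)) (∑A-row j))
          , (λ i → trans (∣tabulate∣≡sum λ j → A j i) (∑A-column i))

  co-regular : Regular (λ j i → not (A j i)) m
  co-regular = (λ j → trans (∣tabulate∣≡sum λ i → not (A j i)) (complement N≡m+m (λ i → ⟦⟧-not (A j i)) (∑A-row j)))
             , (λ i → trans (∣tabulate∣≡sum λ j → not (A j i)) (complement N≡m+m (λ j → ⟦⟧-not (A j i)) (∑A-column i)))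

  R-mem⇒A-false : ∀ {j i} → R.mem j (y i) ≡ true → A j i ≡ false
  R-mem⇒A-false {j} {i} e with A j i | R.mem j (y i) | dual j i
  R-mem⇒A-false refl | false | true | _ = refl

  A-false⇒R-mem : ∀ {j i} → A j i ≡ false → R.mem j (y i) ≡ true
  A-false⇒R-mem {j} {i} e with A j i | R.mem j (y i) | dual j i
  A-false⇒R-mem refl | false | true | _ = refl

-- From the graph to covers by monochromatic cliques

-- Sets without an own vertex are discarded one at a time, by induction on their number.
irredundant : {A : Set} {_∋_ : A → Fin n → Set} → (∀ a v → Dec (a ∋ v)) →
  ∀ N (F : Fin N → A) → (∀ v → ∃ λ i → F i ∋ v) →
  ∃ λ p → Σ (Fin p → A) λ G → (∀ v → ∃ λ i → G i ∋ v) ×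
    (∀ i → ∃ λ v → G i ∋ v × (∀ j → G j ∋ v → j ≡ i))
irredundant _∋?_ zero F cov = zero , F , cov , λ ()
irredundant {_∋_ = _∋_} _∋?_ (suc N) F cov = go (all? own?)
  where
  Own : Fin (suc N) → Set
  Own i = ∃ λ v → F i ∋ v × (∀ j → F j ∋ v → j ≡ i)
  own? : ∀ i → Dec (Own i)
  own? i = any? λ v → (F i ∋? v) ×-dec all? λ j → (F j ∋? v) →-dec (j Fin.≟ i)
  -- The remaining sets still cover: a vertex in no other set would be an own vertex of the
  -- discarded one.
  without : ∀ i → ¬ Own i → ∀ v → ∃ λ j → F (punchIn i j) ∋ v
  without i ¬own v with any? (λ j → (F j ∋? v) ×-dec ¬? (j Fin.≟ i))
  ... | yes (j , Fj∋v , j≢i) = punchOut (j≢i ∘ sym) , subst (λ j → F j ∋ v) (sym (punchIn-punchOut (j≢i ∘ sym))) Fj∋v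
  ... | no ∄j = ⊥-elim (¬own (v , subst (λ j → F j ∋ v) (only _ (proj₂ (cov v))) (proj₂ (cov v)) , only))
    where
    only : ∀ j → F j ∋ v → j ≡ i
    only j Fj∋v = decidable-stable (j Fin.≟ i) λ j≢i → ∄j (j , Fj∋v , j≢i)
  go : Dec (∀ i → Own i) → _
  go (yes own) = suc N , F , cov , own
  go (no ¬own) with i , ¬own-i ← ¬∀⟶∃¬ (suc N) Own own? ¬own
    = irredundant _∋?_ N (F ∘ punchIn i) (without i ¬own-i)

_≟ᶜ_ : (a b : Color) → Dec (a ≡ b)
blue ≟ᶜ blue = yes refl
blue ≟ᶜ red  = no λ ()
red  ≟ᶜ blue = no λ ()
red  ≟ᶜ red  = yes refl

deleteEdge-other : (c : ColGraph (Fin n)) → ∀ {u v a b} → ¬ (a ≡ u × b ≡ v) → ¬ (a ≡ v × b ≡ u) →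
  deleteEdge c u v a b ≡ c a b
deleteEdge-other c {u} {v} {a} {b} ¬uv ¬vu with a Fin.≟ u | b Fin.≟ v | a Fin.≟ v | b Fin.≟ u
... | yes e | yes e′ | _     | _      = contradiction (e , e′) ¬uv
... | yes _ | no _   | yes e | yes e′ = contradiction (e , e′) ¬vu
... | no _  | _      | yes e | yes e′ = contradiction (e , e′) ¬vu
... | yes _ | no _   | yes _ | no _   = refl
... | yes _ | no _   | no _  | _      = refl
... | no _  | _      | yes _ | no _   = refl
... | no _  | _      | no _  | _      = refl

-- Unlike `InMonoClique`, this singles out no vertex, so one clique can serve all its vertices in a
-- cover.
record Clique (c : ColGraph (Fin n)) (k : ℕ) (col : Color) : Set where
  field
    vertex    : Fin k → Fin n
    injective : Injective _≡_ _≡_ vertex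
    adjacent  : ∀ i j → i ≢ j → c (vertex i) (vertex j) ≡ just col

open Clique

_∋_ : {c : ColGraph (Fin n)} {col : Color} → Clique c k col → Fin n → Set
C ∋ v = ∃ λ a → vertex C a ≡ v

_∋?_ : {c : ColGraph (Fin n)} {col : Color} (C : Clique c k col) → ∀ v → Dec (C ∋ v)
C ∋? v = any? λ a → vertex C a Fin.≟ v

clique-size : {c : ColGraph (Fin n)} {col : Color} (C : Clique c k col) → ∑[ v < n ] ⟦ does (C ∋? v) ⟧ ≡ k
clique-size {n} {k} C = begin
  ∑[ v < n ] ⟦ does (C ∋? v) ⟧         ≡⟨ sum-cong-≗ indicator ⟩
  ∑[ v < n ] ∑[ a < k ] ⟦ vertex C a == v ⟧   ≡⟨ ∑-comm (λ v a → ⟦ vertex C a == v ⟧) ⟩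
  ∑[ a < k ] ∑[ v < n ] ⟦ vertex C a == v ⟧   ≡⟨ sum-cong-≗ (sum-==1 ∘ vertex C) ⟩
  ∑[ a < k ] 1                         ≡⟨ sum-1 k ⟩
  k                                    ∎
  where
  open ≡-Reasoning
  indicator : ∀ v → ⟦ does (C ∋? v) ⟧ ≡ ∑[ a < k ] ⟦ vertex C a == v ⟧
  indicator v = go (C ∋? v)
    where
    go : (d : Dec (C ∋ v)) → ⟦ does d ⟧ ≡ ∑[ a < k ] ⟦ vertex C a == v ⟧
    go (yes (a , e)) = sym (sum-image (vertex C) (injective C) e)
    go (no ∄a)       = sym (sum-coimage (vertex C) λ a e → ∄a (a , e))

clique-edge : {c : ColGraph (Fin n)} {col : Color} (C : Clique c k col) → ∀ {u v} → C ∋ u → C ∋ v → u ≢ v → c u v ≡ just col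
clique-edge C (a , refl) (b , refl) u≢v = adjacent C a b λ a≡b → u≢v (cong (vertex C) a≡b)

-- By `joined` and `inside`, the cover determines all edges of its colour between distinct vertices.
record CliqueCover (c : ColGraph (Fin n)) (k : ℕ) (col : Color) (p : ℕ) : Set where
  field
    cover  : Cover k p n
  open Cover cover public
  field
    joined : ∀ i {u v} → mem i u ≡ true → mem i v ≡ true → u ≢ v → c u v ≡ just col
    inside : ∀ {u v} → c u v ≡ just col → ∃ λ i → mem i u ≡ true × mem i v ≡ true

module _ (c : ColGraph (Fin n)) (simple : IsSimple c) (prop : HasProperty c k) (critical : EdgeCritical c k) where

  clique-through : Fin n → ∀ col → Clique c k col
  clique-through v col = let f , f-injective , _ , adj = prop v col in
    record { vertex = f ; injective = f-injective ; adjacent = adj }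

  through : ∀ v col → clique-through v col ∋ v
  through v col = let _ , _ , v∈ , _ = prop v col in v∈

  -- An edge of colour col inside no clique of the cover could be deleted.
  edge-in-clique : ∀ {col} (F : Fin p → Clique c k col) → (∀ v → ∃ λ i → F i ∋ v) →
    ∀ {u v} → c u v ≡ just col → ∃ λ i → F i ∋ u × F i ∋ v
  edge-in-clique {p} {col} F cov {u} {v} uv = decidable-stable (any? λ i → F i ∋? u ×-dec F i ∋? v)
    λ ∄i → critical u v col uv (still ∄i)
    where
    survives : ∀ {col′} (C : Clique c k col′) → ¬ (C ∋ u × C ∋ v) → ∀ {w} → C ∋ w → InMonoClique (deleteEdge c u v) k col′ w
    survives C ¬uv w∈ = vertex C , injective C , w∈ , λ a b a≢b → trans
      (deleteEdge-other c (λ (e , e′) → ¬uv ((a , e) , (b , e′))) (λ (e , e′) → ¬uv ((b , e′) , (a , e))))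
      (adjacent C a b a≢b)
    u≢v : u ≢ v
    u≢v refl = contradiction (trans (sym uv) (proj₂ simple u)) λ ()
    still : ¬ (∃ λ i → F i ∋ u × F i ∋ v) → HasProperty (deleteEdge c u v) k
    still ∄i w col′ with col′ ≟ᶜ col
    ... | yes refl = survives (F (proj₁ (cov w))) (λ both → ∄i (proj₁ (cov w) , both)) (proj₂ (cov w))
    -- A clique of the other colour cannot contain both ends of an edge coloured `col`.
    ... | no  ≢col = survives (clique-through w col′)
      (λ (u∈ , v∈) → ≢col (just-injective (trans (sym (clique-edge (clique-through w col′) u∈ v∈ u≢v)) uv)))
      (through w col′)

  cliqueCover : ∀ col → ∃ (CliqueCover c k col)
  cliqueCover col
    -- The initial family takes one clique through each of the n vertices.
    with p , F , cov , own ← irredundant {_∋_ = _∋_ {c = c} {col}} _∋?_ n (λ v → clique-through v col) (λ v → v , through v col)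
    = p , record
    { cover = record
      { mem    = mem
      ; size   = clique-size ∘ F
      ; covers = λ v → let i , v∈ = cov v in i , true⁺ i v v∈
      ; own    = λ i → let v , v∈ , only = own i in v , true⁺ i v v∈ , trans
          (sum-support (λ j → ⟦ mem j v ⟧) i λ j j≢i → cong ⟦_⟧ (dec-false (F j ∋? v) (j≢i ∘ only j)))
          (⟦⟧≡1 (true⁺ i v v∈))
      }
    ; joined = λ i {u} {v} u∈ v∈ → clique-edge (F i) (true⁻ i u u∈) (true⁻ i v v∈)
    ; inside = λ {u} {v} uv → let i , u∈ , v∈ = edge-in-clique F cov uv in i , true⁺ i u u∈ , true⁺ i v v∈
    }
    where
    mem : Fin p → Fin n → Bool
    mem i v = does (F i ∋? v)
    true⁺ : ∀ i v → F i ∋ v → mem i v ≡ true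
    true⁺ i v = dec-true (F i ∋? v)
    true⁻ : ∀ i v → mem i v ≡ true → F i ∋ v
    true⁻ i v e with F i ∋? v
    ... | yes v∈ = v∈

-- Two distinct common vertices would be joined by an edge both blue and red.
meet≤1 : {c : ColGraph (Fin n)} (B : CliqueCover c k blue p) (R : CliqueCover c k red q) →
  ∀ i j → meet (CliqueCover.cover B) (CliqueCover.cover R) i j ≤ 1
meet≤1 {n} B R i j = subst (_≤ 1) (sum-cong-≗ λ v → ⟦∧⟧ (B.mem i v) (R.mem j v))
  (sum-indicator-≤1 (λ v → B.mem i v ∧ R.mem j v) λ u v eu ev → decidable-stable (u Fin.≟ v) λ u≢v →
    contradiction
      (trans (sym (B.joined i (proj₁ (∧-true eu)) (proj₁ (∧-true ev)) u≢v))
             (R.joined j (proj₂ (∧-true eu)) (proj₂ (∧-true ev)) u≢v))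
      λ ())
  where
  module B = CliqueCover B
  module R = CliqueCover R
  ⟦∧⟧ : ∀ a b → ⟦ a ∧ b ⟧ ≡ ⟦ a ⟧ * ⟦ b ⟧
  ⟦∧⟧ true  b = sym (*-identityˡ ⟦ b ⟧)
  ⟦∧⟧ false b = refl
  ∧-true : ∀ {a b} → a ∧ b ≡ true → a ≡ true × b ≡ true
  ∧-true {true} e = refl , e

-- Identification of the coloured graph with the model

IsModel : (m N : ℕ) → ColGraph (Fin n) → Set
IsModel {n} m N c = Σ (Fin N → Fin N → Bool) λ B →
  Regular B m × Regular (λ x y → not (B x y)) m ×
  Σ (Fin n ⤖ (Fin N ⊎ Fin N)) λ φ →
  ∀ u v col → (c u v ≡ just col → ModelEdge B (Bijection.to φ u) (Bijection.to φ v) col)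
  × (ModelEdge B (Bijection.to φ u) (Bijection.to φ v) col → c u v ≡ just col)

isModel : ∀ {m N} {c : ColGraph (Fin n)} → (∀ v → c v v ≡ nothing) →
  (B : CliqueCover c (suc m) blue N) (R : CliqueCover c (suc m) red N) → N ≡ m + m → N + N ≡ n →
  (∀ i j → meet (CliqueCover.cover B) (CliqueCover.cover R) i j ≡ 1) →
  Transversal (CliqueCover.cover B) (CliqueCover.cover R) → IsModel m N c
isModel {c = c} c-irrefl B R N≡m+m N+N≡n meet≡1 T = A , regular , co-regular , bijection , λ u v col →
    (λ uv → edge⁺ (proj₁ (preimage u)) (proj₁ (preimage v))
      (subst₂ (λ u v → c u v ≡ just col) (sym (proj₂ (preimage u))) (sym (proj₂ (preimage v))) uv))
  , (λ e → subst₂ (λ u v → c u v ≡ just col) (proj₂ (preimage u)) (proj₂ (preimage v)) (edge⁻ e))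
  where
  module B = CliqueCover B
  module R = CliqueCover R
  open Model B.cover R.cover N≡m+m N+N≡n meet≡1 T

  loopless : ∀ {u v col} → c u v ≡ just col → u ≢ v
  loopless {u} uv refl = contradiction (trans (sym uv) (c-irrefl u)) λ ()

  edge⁻ : ∀ {s t col} → ModelEdge A s t col → c (from s) (from t) ≡ just col
  edge⁻ (xy-blue {j} {i} e)     = B.joined i e (y∈ i) (y≢x i j ∘ sym)
  edge⁻ (xy-red {j} {i} e)      = R.joined j (x∈ j) (A-false⇒R-mem e) (y≢x i j ∘ sym)
  edge⁻ (yx-blue {j} {i} e)     = B.joined i (y∈ i) e (y≢x i j)
  edge⁻ (yx-red {j} {i} e)      = R.joined j (A-false⇒R-mem e) (x∈ j) (y≢x i j)
  edge⁻ (xx-blue {y = i} ne e e′) = B.joined i e e′ (ne ∘ x-injective)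
  edge⁻ (yy-red {x = j} ne e e′)  = R.joined j (A-false⇒R-mem e) (A-false⇒R-mem e′) (ne ∘ y-injective)

  edge⁺ : ∀ s t {col} → c (from s) (from t) ≡ just col → ModelEdge A s t col
  edge⁺ (inj₁ j) (inj₁ j′) {blue} uv = let i , e , e′ = B.inside uv in xx-blue (loopless uv ∘ cong x) e e′
  -- The only red set through `x j` is R_j, so a red edge within X would be a loop.
  edge⁺ (inj₁ j) (inj₁ j′) {red}  uv = let _ , e , e′ = R.inside uv in
    contradiction (cong x (trans (sym (x-own e)) (x-own e′))) (loopless uv)
  -- The blue set carrying this edge contains `y i`, hence it is B_i.
  edge⁺ (inj₁ j) (inj₂ i)  {blue} uv with i′ , e , e′ ← B.inside uv with refl ← y-own e′ = xy-blue e
  edge⁺ (inj₁ j) (inj₂ i)  {red}  uv with j′ , e , e′ ← R.inside uv with refl ← x-own e = xy-red (R-mem⇒A-false e′)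
  edge⁺ (inj₂ i) (inj₁ j)  {blue} uv with i′ , e , e′ ← B.inside uv with refl ← y-own e = yx-blue e′
  edge⁺ (inj₂ i) (inj₁ j)  {red}  uv with j′ , e , e′ ← R.inside uv with refl ← x-own e′ = yx-red (R-mem⇒A-false e)
  edge⁺ (inj₂ i) (inj₂ i′) {blue} uv = let _ , e , e′ = B.inside uv in
    contradiction (cong y (trans (sym (y-own e)) (y-own e′))) (loopless uv)
  edge⁺ (inj₂ i) (inj₂ i′) {red}  uv = let j , e , e′ = R.inside uv in
    yy-red (loopless uv ∘ cong y) (R-mem⇒A-false e) (R-mem⇒A-false e′)

theorem3 : (k : ℕ) → 2 ≤ k → (c : ColGraph (Fin (4 * (k ∸ 1)))) → IsSimple c →
    HasProperty c k → EdgeCritical c k →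
    Σ (Fin (2 * (k ∸ 1)) → Fin (2 * (k ∸ 1)) → Bool) λ B →
    Regular B (k ∸ 1) × Regular (λ x y → not (B x y)) (k ∸ 1) ×
    Σ (Fin (4 * (k ∸ 1)) ⤖ (Fin (2 * (k ∸ 1)) ⊎ Fin (2 * (k ∸ 1)))) λ φ →
    ∀ u v col → (c u v ≡ just col → ModelEdge B (Bijection.to φ u) (Bijection.to φ v) col)
    × (ModelEdge B (Bijection.to φ u) (Bijection.to φ v) col → c u v ≡ just col)
theorem3 (suc zero) (s≤s ())
theorem3 (suc (suc h)) _ c simple prop critical =
  isModel (proj₂ simple) B R
    (cong (suc h +_) (+-identityʳ (suc h))) (sym (*-distribʳ-+ (suc h) 2 2))
    (Extremal.meet≡1 h (CliqueCover.cover B) (CliqueCover.cover R) (meet≤1 B R))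
    (transversal h (CliqueCover.cover B) (CliqueCover.cover R) (meet≤1 B R))
  where
  blues = cliqueCover c simple prop critical blue
  reds  = cliqueCover c simple prop critical red
  B₀ = CliqueCover.cover (proj₂ blues)
  R₀ = CliqueCover.cover (proj₂ reds)
  meet≤1₀ = meet≤1 (proj₂ blues) (proj₂ reds)
  -- The irredundant covers come with unknown sizes; `cover-size`, applied in both orders, fixes
  -- them at 2(k - 1).
  B : CliqueCover c (2 + h) blue (2 * suc h)
  B = subst (CliqueCover c (2 + h) blue) (cover-size h B₀ R₀ meet≤1₀) (proj₂ blues)
  R : CliqueCover c (2 + h) red (2 * suc h)
  R = subst (CliqueCover c (2 + h) red)
    (cover-size h R₀ B₀ λ j i → subst (_≤ 1) (meet-comm B₀ R₀ i j) (meet≤1₀ i j)) (proj₂ reds)
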